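{- Let $G$ be an Abelian group of order $n$, let $K=(k_1,\dots,k_m)$ be a tuple of positive integers, $a=\sum_{i}k_i$ and $\widetilde{k}=\mathrm{lcm}(k_1,\dots,k_m)$. A necessary condition for the existence of an $(n,m,K,a,d)$-RWEDF over $G$, or equivalently of a weak $(n,m,a,\rho)$-AMD code $(S,G,\mathcal{A},E_u)$ with $S=\{s_1,\dots,s_m\}$, $|A_{s_i}|=k_i$ for $1\le i\le m$, and $\rho=\frac{a(m-1)}{m(n-1)}$, is $(n-1)\mid \widetilde{k}a(m-1)$.
   Context: All groups are written additively with identity $0$. RWEDF: let $\mathcal{B}=\{B_i:1\le i\le m\}$ be a family of pairwise disjoint nonempty subsets of $G$ with $k_i=|B_i|$, $K=(k_1,\dots,k_m)$, $a=\sum_i k_i$. For $\delta\in G\setminus\{0\}$ let $N_i(\delta)=|\{(b_i,b_j): b_i\in B_i,\ b_j\in\bigcup_{t\ne i}B_t,\ b_j-b_i=\delta\}|$. Then $\mathcal{B}$ is an $(n,m,K,a,d)$ reciprocally-weighted external difference family (RWEDF) if $\sum_{i=1}^m\frac{N_i(\delta)}{k_i}=d$ for each $\delta\in G\setminus\{0\}$. Weak AMD code: let $S$ be a set of $m$ source messages and $\mathcal{A}=\{A_s : s\in S\}$ a family of pairwise disjoint nonempty subsets of $G$. A source $s\in S$ is chosen uniformly at random, and $E_u$ encodes $s$ as a uniformly random $g\in A_s$. The adversary, with no knowledge of $s$ or $g$, chooses $\Delta\in G\setminus\{0\}$ and wins if $g+\Delta\in A_{s'}$ for some $s'\neq s$.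 Let $\rho_\Delta$ be the probability of winning with $\Delta$, i.e. $\rho_\Delta=\frac1m\sum_{s\in S}\frac{1}{|A_s|}\,|\{g\in A_s : g+\Delta\in\bigcup_{s'\ne s}A_{s'}\}|$. Then $(S,G,\mathcal{A},E_u)$ is a weak $(n,m,a,\rho)$-AMD code, where $a=\sum_{s\in S}|A_s|$ and $\rho=\max\{\rho_\Delta : \Delta\in G\setminus\{0\}\}$; it is $R$-optimal with respect to the Paterson–Stinson bound when $\rho=\frac{a(m-1)}{m(n-1)}$. Here $n\ge2$. -}

module Defs where

open import Algebra.Bundles using (AbelianGroup)
open import Data.Fin.Base using (Fin)
import Data.Fin.Properties as Fin
open import Data.Fin.Subset using (Subset; _∈_; _∩_; ⋃; ∣_∣; Nonempty; Empty)
open import Data.Fin.Subset.Properties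
  using (_∈?_; x∈⁅y⁆⇒x≡y; ∣⁅x⁆∣≡1; p⊆q⇒∣p∣≤∣q∣)
open import Data.Integer.Base using (+_)
open import Data.List.Base using (allFin; cartesianProduct; filter; length; map)
open import Data.Nat.Base as ℕ using (ℕ; NonZero; NonTrivial; _∸_; >-nonZero)
import Data.Nat.LCM as ℕ
import Data.Nat.Properties as ℕ
open import Data.Product.Base using (_×_; _,_; ∃-syntax)
open import Data.Rational.Base using (ℚ; _/_; _*_; _≤_)
import Data.Rational.Properties as ℚ
open import Data.Vec.Functional using (Vector; foldr)
open import Function.Bundles using (Inverse; _↔_)
open import Function.Construct.Identity using (↔-id)
open import Function.Construct.Symmetry using (↔-sym)
open import Function.Properties.Inverse using (Inverse⇒Injection)
open import Relation.Binary.Definitions using (Decidable; DecidableEquality)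
open import Relation.Binary.PropositionalEquality as ≡ using (_≡_; _≢_)
open import Relation.Nullary.Decidable using (_×-dec_; ¬?; via-injection)
open import Relation.Nullary.Negation using (¬_)
import Level

open import Algebra.Properties.CommutativeMonoid.Sum ℕ.+-0-commutativeMonoid public
  using () renaming (sum to sumℕ)
open import Algebra.Properties.CommutativeMonoid.Sum ℚ.+-0-commutativeMonoid public
  using () renaming (sum to sumℚ)

lcm : ∀ {m} → Vector ℕ m → ℕ
lcm = foldr ℕ.lcm 1

size≢0 : ∀ {n} {p : Subset n} → Nonempty p → NonZero ∣ p ∣
size≢0 {p = p} (x , x∈p) = >-nonZero (≡.subst (ℕ._≤ ∣ p ∣) (∣⁅x⁆∣≡1 x)
  (p⊆q⇒∣p∣≤∣q∣ λ y∈⁅x⁆ → ≡.subst (_∈ p) (≡.sym (x∈⁅y⁆⇒x≡y x y∈⁅x⁆)) x∈p))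

n∸1≢0 : ∀ n .{{_ : NonTrivial n}} → NonZero (n ∸ 1)
n∸1≢0 n@(ℕ.2+ _) = _

record IsDisjointFamily {i} {I : Set i} {n} (B : I → Subset n) : Set i where
  field
    nonempty : ∀ s → Nonempty (B s)
    disjoint : ∀ s t → s ≢ t → Empty (B s ∩ B t)

-- The union of all B t with t ≢ s, for a family indexed by a finite set.
⋃-others : ∀ {i} {I : Set i} {m n} → Fin m ↔ I → (I → Subset n) → I → Subset n
⋃-others {I = I} {m} finite B s =
  ⋃ (map B (filter (λ t → ¬? (t ≟ s)) (map (Inverse.to finite) (allFin m))))
  where
  _≟_ : DecidableEquality I
  _≟_ = via-injection (Inverse⇒Injection (↔-sym finite)) Fin._≟_

-- G has order n, witnessed by an enumeration of its elements up to _≈_.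
-- A subset of G is the Subset n of the positions of its elements.
module _ {c ℓ} (G : AbelianGroup c ℓ) {n : ℕ}
         (order : Inverse (AbelianGroup.setoid G) (≡.setoid (Fin n))) where

  open AbelianGroup G
    using (Carrier; _≈_; _-_) renaming (_∙_ to _+ᴳ_; ε to 0ᴳ)
  open Inverse order using () renaming (to to index; from to element)

  _≈?_ : Decidable _≈_
  _≈?_ = via-injection (Inverse⇒Injection order) Fin._≟_

  module _ {m : ℕ} where

    N : (Fin m → Subset n) → Fin m → Carrier → ℕ
    N B i δ = length (filter
      (λ (b , b′) → (b ∈? B i) ×-dec (b′ ∈? ⋃-others (↔-id (Fin m)) B i)
                      ×-dec ((element b′ - element b) ≈? δ))
      (cartesianProduct (allFin n) (allFin n)))

    record IsRWEDF (K : Vector ℕ m) (a : ℕ) (d : ℚ) (B : Fin m → Subset n) :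
                   Set (c Level.⊔ ℓ) where
      field
        isDisjointFamily : IsDisjointFamily B
      open IsDisjointFamily isDisjointFamily public
      field
        sizes      : ∀ i → ∣ B i ∣ ≡ K i
        total      : sumℕ K ≡ a
        reciprocal : ∀ δ → ¬ δ ≈ 0ᴳ →
          sumℚ (λ i → (+ N B i δ / ∣ B i ∣) {{size≢0 (nonempty i)}}) ≡ d

  module _ {m : ℕ} .{{_ : NonZero m}} {s} {S : Set s} (sources : Fin m ↔ S) where

    open Inverse sources using () renaming (to to source)

    -- The number of encodings g of s that the shift by Δ takes to an encoding
    -- of another source.
    wins : (S → Subset n) → S → Carrier → ℕ
    wins A s Δ = length (filter
      (λ g → (g ∈? A s) ×-dec (index (element g +ᴳ Δ) ∈? ⋃-others sources A s))
      (allFin n))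

    -- ρ_Δ, for s uniform on S and g uniform on A s.
    winProbability : (A : S → Subset n) → (∀ s → Nonempty (A s)) → Carrier → ℚ
    winProbability A nonempty Δ = (+ 1 / m) * sumℚ λ i →
      let s = source i in
      (+ 1 / ∣ A s ∣) {{size≢0 (nonempty s)}} * (+ wins A s Δ / 1)

    record IsWeakAMDCode (a : ℕ) (ρ : ℚ) (A : S → Subset n) :
                         Set (c Level.⊔ ℓ Level.⊔ s) where
      field
        isDisjointFamily : IsDisjointFamily A
      open IsDisjointFamily isDisjointFamily public
      field
        total      : sumℕ (λ i → ∣ A (source i) ∣) ≡ a
        ρ-bounds   : ∀ Δ → ¬ Δ ≈ 0ᴳ → winProbability A nonempty Δ ≤ ρ
        ρ-attained : ∃[ Δ ] ¬ Δ ≈ 0ᴳ × winProbability A nonempty Δ ≡ ρ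

-- a (m − 1) / (m (n − 1)), the Paterson–Stinson bound.
R-bound : (n m a : ℕ) .{{_ : NonTrivial n}} .{{_ : NonZero m}} → ℚ
R-bound n m a = + (a ℕ.* (m ∸ 1)) / (m ℕ.* (n ∸ 1))
  where instance
    _ = n∸1≢0 n
    _ = ℕ.m*n≢0 m (n ∸ 1)

{-# OPTIONS --safe #-}

-- Clear denominators: W δ = Σ_i (k̃ / k_i) N_i(δ) is a natural number, the RWEDF sum at δ is
-- W δ / k̃, and the winning probability at δ is W δ / (m k̃), because b′ is determined by b in
-- b′ − b = δ. Counting pairs gives W 0 = 0 and Σ_δ W δ = k̃ a (m − 1), so W is constant off 0 iff
-- it nowhere exceeds its mean k̃ a (m − 1) / (n − 1) there. In an RWEDF this mean is a value of W,
-- hence an integer.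
module Submission where

open import Defs
open import Algebra.Bundles using (AbelianGroup)
import Algebra.Properties.Group as GroupProperties
open import Data.Bool.Base using (if_then_else_; true; false)
open import Data.Fin.Base using (Fin; zero; suc; punchIn; punchOut)
open import Data.Fin.Permutation using (Permutation′; permutation)
open import Data.Fin.Properties as Fin using (any?; punchInᵢ≢i; punchIn-punchOut)
open import Data.Fin.Subset using (Subset; Empty; Nonempty; _∈_; _∩_; ⋃; ∣_∣; inside; outside)
open import Data.Fin.Subset.Properties using (_∈?_; x∈p∪q⁺; x∈p∪q⁻; x∈p∩q⁺; ∉⊥)
open import Data.Integer.Base as ℤ using (+_)
import Data.Integer.Properties as ℤ
open import Data.List.Base
  using (List; allFin; cartesianProduct; filter; length; map; tabulate; _++_; []; _∷_)
open import Data.List.Membership.Propositional using () renaming (_∈_ to _∈ˡ_)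
open import Data.List.Membership.Propositional.Properties
  using (∈-map⁺; ∈-map⁻; ∈-filter⁺; ∈-filter⁻; ∈-allFin)
open import Data.List.Properties using (filter-++; length-++; map-tabulate)
open import Data.List.Relation.Unary.Any using (here; there)
open import Data.Nat.Base as ℕ
  using (ℕ; zero; suc; NonZero; NonTrivial; _+_; _*_; _∸_; _≤_; ≢-nonZero; ≢-nonZero⁻¹;
    nonTrivial⇒n>1)
open import Data.Nat.Divisibility using (_∣_; divides; quotient; ∣-trans; 0∣⇒≡0; m∣m*n; n∣m*n)
import Data.Nat.LCM as ℕ
import Data.Nat.Properties as ℕ
open import Data.Nat.Solver using (module +-*-Solver)
open import Data.Product.Base using (_×_; _,_; proj₂; ∃-syntax)
open import Data.Rational.Base as ℚ using (ℚ; _/_; toℚᵘ)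
import Data.Rational.Properties as ℚ
open import Data.Rational.Unnormalised.Base as ℚᵘ using (mkℚᵘ; *≡*)
import Data.Rational.Unnormalised.Properties as ℚᵘ
open import Data.Sum.Base using (inj₁; inj₂)
open import Data.Vec.Base using ([]; _∷_)
open import Data.Vec.Functional using (Vector)
open import Function.Base using (_∘_; id)
open import Function.Bundles using (Inverse; _↔_; _⇔_; mk⇔)
open import Function.Construct.Identity using (↔-id)
open import Relation.Binary.PropositionalEquality
  using (_≡_; _≢_; refl; sym; trans; cong; cong₂; subst; subst₂; setoid; module ≡-Reasoning)
open import Relation.Nullary.Decidable
  using (Dec; yes; no; does; _because_; _×-dec_; dec-true; dec-false; does-⇔)
open import Relation.Nullary.Negation using (¬_; contradiction)
open import Level using (Level)
open import Relation.Unary using (Pred) renaming (Decidable to Decidable₁)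

open import Algebra.Properties.CommutativeMonoid.Sum ℕ.+-0-commutativeMonoid
  using (sum-cong-≗; sum-replicate-zero; sum-remove; ∑-comm; ∑-distrib-+; sum-permute)
open import Algebra.Properties.CommutativeMonoid.Sum ℚ.+-0-commutativeMonoid
  using () renaming (sum-cong-≗ to sumℚ-cong-≗)
open import Algebra.Properties.Semiring.Sum ℕ.+-*-semiring
  using (*-distribˡ-sum; *-distribʳ-sum)

private variable
  ℓ ℓ′ : Level
  P Q : Set ℓ
  m n : ℕ

-- Indicator functions and counting

χ : Dec P → ℕ
χ d = if does d then 1 else 0

χ-cong : P ⇔ Q → (P? : Dec P) (Q? : Dec Q) → χ P? ≡ χ Q?
χ-cong P⇔Q P? Q? = cong (if_then 1 else 0) (does-⇔ P⇔Q P? Q?)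

χ-yes : (P? : Dec P) → P → χ P? ≡ 1
χ-yes P? p = cong (if_then 1 else 0) (dec-true P? p)

χ-no : (P? : Dec P) → ¬ P → χ P? ≡ 0
χ-no P? ¬p = cong (if_then 1 else 0) (dec-false P? ¬p)

χ-× : (P? : Dec P) (Q? : Dec Q) → χ (P? ×-dec Q?) ≡ χ P? * χ Q?
χ-× (true  because _) (q because _) = sym (ℕ.+-identityʳ _)
χ-× (false because _) _             = refl

module _ {A : Set ℓ} {R : Pred A ℓ′} (R? : Decidable₁ R) where

  -- Stated for an arbitrary `f`, because `allFin n` is `tabulate id` and the induction passes from
  -- `f` to `f ∘ suc`.
  length-filter-tabulate : (f : Fin n → A) →
    length (filter R? (tabulate f)) ≡ sumℕ λ x → χ (R? (f x))
  length-filter-tabulate {zero}  f = refl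
  length-filter-tabulate {suc n} f with does (R? (f zero))
  ... | true  = cong suc (length-filter-tabulate (f ∘ suc))
  ... | false = length-filter-tabulate (f ∘ suc)

length-filter-cartesianProduct :
  ∀ {A B : Set} {R : Pred (A × B) ℓ} (R? : Decidable₁ R) (f : Fin m → A) (g : Fin n → B) →
  length (filter R? (cartesianProduct (tabulate f) (tabulate g))) ≡
  sumℕ λ x → sumℕ λ y → χ (R? (f x , g y))
length-filter-cartesianProduct {m = zero}  R? f g = refl
length-filter-cartesianProduct {m = suc m} R? f g = begin
  length (filter R? (row ++ rows))                  ≡⟨ cong length (filter-++ R? row rows) ⟩
  length (filter R? row ++ filter R? rows)          ≡⟨ length-++ (filter R? row) ⟩
  length (filter R? row) + length (filter R? rows)  ≡⟨ cong₂ _+_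
    (trans (cong (length ∘ filter R?) (map-tabulate g (f zero ,_)))
      (length-filter-tabulate R? λ y → f zero , g y))
    (length-filter-cartesianProduct R? (f ∘ suc) g) ⟩
  _ ∎
  where
  open ≡-Reasoning
  row  = map (f zero ,_) (tabulate g)
  rows = cartesianProduct (tabulate (f ∘ suc)) (tabulate g)

∣p∣≡∑χ : (p : Subset n) → ∣ p ∣ ≡ sumℕ λ x → χ (x ∈? p)
∣p∣≡∑χ []            = refl
∣p∣≡∑χ (inside  ∷ p) = cong suc (∣p∣≡∑χ p)
∣p∣≡∑χ (outside ∷ p) = ∣p∣≡∑χ p

-- Finite sums of natural numbers

∑-zero : {f : Vector ℕ n} → (∀ x → f x ≡ 0) → sumℕ f ≡ 0
∑-zero {n} f≡0 = trans (sum-cong-≗ f≡0) (sum-replicate-zero n)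

∑-const : ∀ n {f : Vector ℕ n} {c} → (∀ x → f x ≡ c) → sumℕ f ≡ n * c
∑-const zero    f≡c = refl
∑-const (suc n) f≡c = cong₂ _+_ (f≡c zero) (∑-const n (f≡c ∘ suc))

∑-single : (f : Vector ℕ n) (y : Fin n) → (∀ x → x ≢ y → f x ≡ 0) → sumℕ f ≡ f y
∑-single {suc n} f y f≡0 = begin
  sumℕ f                             ≡⟨ sum-remove {i = y} f ⟩
  f y + sumℕ (λ x → f (punchIn y x)) ≡⟨ cong₂ _+_ refl (∑-zero λ x → f≡0 _ (punchInᵢ≢i y x)) ⟩
  f y + 0                            ≡⟨ ℕ.+-identityʳ _ ⟩
  f y                                ∎
  where open ≡-Reasoning

∑-punctured-const : (f : Vector ℕ n) (z : Fin n) {c : ℕ} → f z ≡ 0 →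
  (∀ x → x ≢ z → f x ≡ c) → sumℕ f ≡ (n ∸ 1) * c
∑-punctured-const {suc n} f z fz≡0 f≡c = trans (sum-remove {i = z} f)
  (cong₂ _+_ fz≡0 (∑-const n λ x → f≡c _ (punchInᵢ≢i z x)))

∑-≤ : ∀ n {f : Vector ℕ n} {c} → (∀ x → f x ≤ c) → sumℕ f ≤ n * c
∑-≤ zero    f≤c = ℕ.z≤n
∑-≤ (suc n) f≤c = ℕ.+-mono-≤ (f≤c zero) (∑-≤ n (f≤c ∘ suc))

-- The terms other than `f x` contribute at most `c` each, so a sum that reaches the maximum forces
-- `c ≤ f x`.
∑-≤-tight : (f : Vector ℕ n) {c : ℕ} → (∀ x → f x ≤ c) → sumℕ f ≡ n * c → ∀ x → f x ≡ c
∑-≤-tight {suc n} f {c} f≤c ∑≡ x = ℕ.≤-antisym (f≤c x) (ℕ.+-cancelʳ-≤ (n * c) c (f x) (begin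
  c + n * c                          ≡⟨ ∑≡ ⟨
  sumℕ f                             ≡⟨ sum-remove {i = x} f ⟩
  f x + sumℕ (λ y → f (punchIn x y)) ≤⟨ ℕ.+-monoʳ-≤ (f x) (∑-≤ n λ y → f≤c (punchIn x y)) ⟩
  f x + n * c                        ∎))
  where open ℕ.≤-Reasoning

-- Deleting the zero term at `z` leaves the sum unchanged over `n ∸ 1` indices, where `∑-≤-tight`
-- applies.
∑-punctured-≤-tight : (f : Vector ℕ n) (z : Fin n) {c : ℕ} → f z ≡ 0 →
  (∀ x → x ≢ z → f x ≤ c) → sumℕ f ≡ (n ∸ 1) * c → ∀ x → x ≢ z → f x ≡ c
∑-punctured-≤-tight {suc n} f z {c} fz≡0 f≤c ∑≡ x x≢z =
  subst (λ y → f y ≡ c) (punchIn-punchOut z≢x)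
    (∑-≤-tight (f ∘ punchIn z) (λ y → f≤c _ (punchInᵢ≢i z y))
      (trans (sym (trans (sum-remove {i = z} f) (cong₂ _+_ fz≡0 refl))) ∑≡)
      (punchOut z≢x))
  where
  z≢x : z ≢ x
  z≢x z≡x = x≢z (sym z≡x)

∃≢ : .{{NonTrivial n}} → (z : Fin n) → ∃[ x ] x ≢ z
∃≢ {suc zero} z = contradiction (nonTrivial⇒n>1 1) (ℕ.<-irrefl refl)
∃≢ {ℕ.2+ _} zero    = suc zero , λ ()
∃≢ {ℕ.2+ _} (suc z) = zero , λ ()

-- Least common multiples

∣lcm : (K : Vector ℕ m) → ∀ i → K i ∣ lcm K
∣lcm {suc m} K zero    = ℕ.m∣lcm[m,n] (K zero) _
∣lcm {suc m} K (suc i) = ∣-trans (∣lcm (K ∘ suc) i) (ℕ.n∣lcm[m,n] (K zero) _)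

-- The lcm divides the product of the head and the lcm of the tail. That product is nonzero, and
-- zero divides only zero.
lcm≢0 : (K : Vector ℕ m) → (∀ i → NonZero (K i)) → NonZero (lcm K)
lcm≢0 {zero}  K K≢0 = _
lcm≢0 {suc m} K K≢0 = ≢-nonZero λ lcm≡0 → ≢-nonZero⁻¹ (K zero * lcm (K ∘ suc))
  (0∣⇒≡0 (subst (_∣ K zero * lcm (K ∘ suc)) lcm≡0
    (ℕ.lcm-least {K zero} {lcm (K ∘ suc)} (m∣m*n _) (n∣m*n (K zero)))))
  where instance
    _ = K≢0 zero
    _ = lcm≢0 (K ∘ suc) (K≢0 ∘ suc)
    _ = ℕ.m*n≢0 (K zero) (lcm (K ∘ suc))

-- Fractions with natural numerators

-- The quotient `_/_` on `ℚ` cancels common factors, so it does not reduce for variable arguments.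
-- Unnormalised fractions keep numerator and denominator, and the laws below are proved there and
-- pulled back.
toℚᵘ-/ : ∀ p a .{{_ : NonZero a}} → toℚᵘ (+ p / a) ℚᵘ.≃ + p ℚᵘ./ a
toℚᵘ-/ p (suc a) = ℚ.toℚᵘ-fromℚᵘ (mkℚᵘ (+ p) a)

≃⁺ : ∀ {p q} a b .{{_ : NonZero a}} .{{_ : NonZero b}} →
  p * b ≡ q * a → + p ℚᵘ./ a ℚᵘ.≃ + q ℚᵘ./ b
≃⁺ {p} {q} (suc a) (suc b) eq = *≡* (begin
  + p ℤ.* + suc b  ≡⟨ ℤ.pos-* p (suc b) ⟨
  + (p * suc b)    ≡⟨ cong +_ eq ⟩
  + (q * suc a)    ≡⟨ ℤ.pos-* q (suc a) ⟩
  + q ℤ.* + suc a  ∎)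
  where open ≡-Reasoning

/-≡⁺ : ∀ p q a b .{{_ : NonZero a}} .{{_ : NonZero b}} →
  p * b ≡ q * a → + p / a ≡ + q / b
/-≡⁺ p q a b eq = ℚ.toℚᵘ-injective
  (ℚᵘ.≃-trans (toℚᵘ-/ p a) (ℚᵘ.≃-trans (≃⁺ a b eq) (ℚᵘ.≃-sym (toℚᵘ-/ q b))))

/-≤⁻ : ∀ p q a b .{{_ : NonZero a}} .{{_ : NonZero b}} →
  + p / a ℚ.≤ + q / b → p * b ≤ q * a
/-≤⁻ p q a@(suc _) b@(suc _) p/a≤q/b = ℤ.drop‿+≤+
  (subst₂ ℤ._≤_ (sym (ℤ.pos-* p b)) (sym (ℤ.pos-* q a)) (ℚᵘ.drop-*≤* (begin
    + p ℚᵘ./ a     ≃⟨ toℚᵘ-/ p a ⟨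
    toℚᵘ (+ p / a) ≤⟨ ℚ.toℚᵘ-mono-≤ p/a≤q/b ⟩
    toℚᵘ (+ q / b) ≃⟨ toℚᵘ-/ q b ⟩
    + q ℚᵘ./ b     ∎)))
  where open ℚᵘ.≤-Reasoning

/-≡⁻ : ∀ p q a .{{_ : NonZero a}} → + p / a ≡ + q / a → p ≡ q
/-≡⁻ p q a p/a≡q/a = ℕ.≤-antisym
  (ℕ.*-cancelʳ-≤ _ _ a (/-≤⁻ p q a a (ℚ.≤-reflexive p/a≡q/a)))
  (ℕ.*-cancelʳ-≤ _ _ a (/-≤⁻ q p a a (ℚ.≤-reflexive (sym p/a≡q/a))))

+-/ : ∀ p q a .{{_ : NonZero a}} → + p / a ℚ.+ + q / a ≡ + (p + q) / a
+-/ p q a@(suc _) = ℚ.toℚᵘ-injective (begin-equality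
  toℚᵘ (+ p / a ℚ.+ + q / a)         ≃⟨ ℚ.toℚᵘ-homo-+ (+ p / a) (+ q / a) ⟩
  toℚᵘ (+ p / a) ℚᵘ.+ toℚᵘ (+ q / a) ≃⟨ ℚᵘ.+-cong (toℚᵘ-/ p a) (toℚᵘ-/ q a) ⟩
  + p ℚᵘ./ a ℚᵘ.+ + q ℚᵘ./ a         ≡⟨ ℚᵘ./-cong (trans
    (cong₂ ℤ._+_ (sym (ℤ.pos-* p a)) (sym (ℤ.pos-* q a))) (sym (ℤ.pos-+ (p * a) (q * a)))) refl ⟩
  + (p * a + q * a) ℚᵘ./ (a * a)     ≃⟨ ≃⁺ (a * a) a
    (solve 3 (λ p q a → (p :* a :+ q :* a) :* a := (p :+ q) :* (a :* a)) refl p q a) ⟩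
  + (p + q) ℚᵘ./ a                   ≃⟨ toℚᵘ-/ (p + q) a ⟨
  toℚᵘ (+ (p + q) / a)               ∎)
  where
  open ℚᵘ.≤-Reasoning
  open +-*-Solver

*-/ : ∀ p q a b .{{_ : NonZero a}} .{{_ : NonZero b}} →
  (+ p / a) ℚ.* (+ q / b) ≡ (+ (p * q) / (a * b)) {{ℕ.m*n≢0 a b}}
*-/ p q a@(suc _) b@(suc _) = ℚ.toℚᵘ-injective (begin-equality
  toℚᵘ ((+ p / a) ℚ.* (+ q / b))     ≃⟨ ℚ.toℚᵘ-homo-* (+ p / a) (+ q / b) ⟩
  toℚᵘ (+ p / a) ℚᵘ.* toℚᵘ (+ q / b) ≃⟨ ℚᵘ.*-cong (toℚᵘ-/ p a) (toℚᵘ-/ q b) ⟩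
  (+ p ℚᵘ./ a) ℚᵘ.* (+ q ℚᵘ./ b)     ≡⟨ ℚᵘ./-cong (sym (ℤ.pos-* p q)) refl ⟩
  + (p * q) ℚᵘ./ (a * b)             ≃⟨ toℚᵘ-/ (p * q) (a * b) ⟨
  toℚᵘ (+ (p * q) / (a * b))         ∎)
  where open ℚᵘ.≤-Reasoning

∑-/ : ∀ d .{{_ : NonZero d}} (f : Vector ℕ m) →
  sumℚ (λ i → + f i / d) ≡ + sumℕ f / d
-- The empty sum is zero over denominator 1 and has to be rewritten over `d`.
∑-/ {zero}  d f = /-≡⁺ 0 0 1 d refl
∑-/ {suc m} d f = trans (cong₂ ℚ._+_ {x = + f zero / d} refl (∑-/ d (f ∘ suc))) (+-/ (f zero) _ d)

-- Disjoint families

∈⋃⁺ : ∀ {x p} {ps : List (Subset n)} → p ∈ˡ ps → x ∈ p → x ∈ ⋃ ps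
∈⋃⁺ (here refl) x∈p  = x∈p∪q⁺ (inj₁ x∈p)
∈⋃⁺ (there p∈ps) x∈p = x∈p∪q⁺ (inj₂ (∈⋃⁺ p∈ps x∈p))

∈⋃⁻ : ∀ {x} (ps : List (Subset n)) → x ∈ ⋃ ps → ∃[ p ] p ∈ˡ ps × x ∈ p
∈⋃⁻ []       x∈⊥ = contradiction x∈⊥ ∉⊥
∈⋃⁻ (p ∷ ps) x∈∪ with x∈p∪q⁻ p (⋃ ps) x∈∪
... | inj₁ x∈p  = p , here refl , x∈p
... | inj₂ x∈ps = let q , q∈ps , x∈q = ∈⋃⁻ ps x∈ps in q , there q∈ps , x∈q

module _ {I : Set ℓ} (finite : Fin m ↔ I) (B : I → Subset n) {s : I} {x : Fin n} where

  open Inverse finite using (to; from; strictlyInverseˡ)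

  ∈⋃-others⁺ : ∀ {t} → t ≢ s → x ∈ B t → x ∈ ⋃-others finite B s
  ∈⋃-others⁺ {t} t≢s = ∈⋃⁺ (∈-map⁺ B (∈-filter⁺ _
    -- The index `t` occurs in the enumeration as `to (from t)`.
    (subst (_∈ˡ map to (allFin m)) (strictlyInverseˡ t) (∈-map⁺ to (∈-allFin (from t)))) t≢s))

  ∈⋃-others⁻ : x ∈ ⋃-others finite B s → ∃[ t ] t ≢ s × x ∈ B t
  ∈⋃-others⁻ x∈O with ∈⋃⁻ (map B (filter _ (map to (allFin m)))) x∈O
  ... | _ , p∈ps , x∈p with ∈-map⁻ B p∈ps
  ... | t , t∈ts , refl = t , proj₂ (∈-filter⁻ _ {xs = map to (allFin m)} t∈ts) , x∈p

module _ (B : Fin m → Subset n) (B-disjoint : ∀ i j → i ≢ j → Empty (B i ∩ B j)) where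

  others : Fin m → Subset n
  others = ⋃-others (↔-id (Fin m)) B

  disjoint-∈ : ∀ {i j x} → x ∈ B i → x ∈ B j → i ≡ j
  disjoint-∈ {i} {j} x∈i x∈j with i Fin.≟ j
  ... | yes i≡j = i≡j
  ... | no  i≢j = contradiction (_ , x∈p∩q⁺ (x∈i , x∈j)) (B-disjoint i j i≢j)

  ∉others : ∀ {i x} → x ∈ B i → ¬ x ∈ others i
  ∉others x∈i x∈O with ∈⋃-others⁻ (↔-id (Fin m)) B x∈O
  ... | t , t≢i , x∈t = t≢i (disjoint-∈ x∈t x∈i)

  -- By disjointness at most one block contains `x`. If none does, every term vanishes. If `B t`
  -- does, the right side is 1, and on the left exactly one term is 1, according to whether `t ≡ i`.
  χ-others : ∀ i x → χ (x ∈? others i) + χ (x ∈? B i) ≡ sumℕ λ t → χ (x ∈? B t)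
  χ-others i x with any? (λ t → x ∈? B t)
  ... | no ∄t = trans
    (cong₂ _+_ (χ-no (x ∈? others i) λ x∈O →
                 let t , _ , x∈t = ∈⋃-others⁻ (↔-id (Fin m)) B x∈O in ∄t (t , x∈t))
               (χ-no (x ∈? B i) λ x∈i → ∄t (i , x∈i)))
    (sym (∑-zero λ t → χ-no (x ∈? B t) λ x∈t → ∄t (t , x∈t)))
  ... | yes (t , x∈t) = trans exactly-one (sym (trans
    (∑-single (λ u → χ (x ∈? B u)) t λ u u≢t → χ-no (x ∈? B u) λ x∈u → u≢t (disjoint-∈ x∈u x∈t))
    (χ-yes (x ∈? B t) x∈t)))
    where
    exactly-one : χ (x ∈? others i) + χ (x ∈? B i) ≡ 1
    exactly-one with t Fin.≟ i
    ... | yes refl = cong₂ _+_ (χ-no (x ∈? others i) (∉others x∈t)) (χ-yes (x ∈? B i) x∈t)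
    ... | no  t≢i  = cong₂ _+_ (χ-yes (x ∈? others i) (∈⋃-others⁺ (↔-id (Fin m)) B t≢i x∈t))
                               (χ-no (x ∈? B i) λ x∈i → t≢i (disjoint-∈ x∈t x∈i))

  -- Sum `χ-others` over all `x` and exchange the summations. The additive form avoids truncated
  -- subtraction.
  ∣others∣ : ∀ i → ∣ others i ∣ + ∣ B i ∣ ≡ sumℕ λ t → ∣ B t ∣
  ∣others∣ i = begin
    ∣ others i ∣ + ∣ B i ∣
      ≡⟨ cong₂ _+_ (∣p∣≡∑χ (others i)) (∣p∣≡∑χ (B i)) ⟩
    sumℕ (λ x → χ (x ∈? others i)) + sumℕ (λ x → χ (x ∈? B i))
      ≡⟨ ∑-distrib-+ (λ x → χ (x ∈? others i)) (λ x → χ (x ∈? B i)) ⟨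
    sumℕ (λ x → χ (x ∈? others i) + χ (x ∈? B i))
      ≡⟨ sum-cong-≗ (χ-others i) ⟩
    sumℕ (λ x → sumℕ λ t → χ (x ∈? B t))
      ≡⟨ ∑-comm (λ x t → χ (x ∈? B t)) ⟩
    sumℕ (λ t → sumℕ λ x → χ (x ∈? B t))
      ≡⟨ sum-cong-≗ (λ t → sym (∣p∣≡∑χ (B t))) ⟩
    sumℕ (λ t → ∣ B t ∣) ∎
    where open ≡-Reasoning

  -- Summing `∣others∣` over the `m` blocks gives `m * a`, and one copy of `a` cancels.
  ∑∣others∣ : .{{_ : NonZero m}} → sumℕ (λ i → ∣ others i ∣) ≡ sumℕ (λ i → ∣ B i ∣) * (m ∸ 1)
  ∑∣others∣ = ℕ.+-cancelʳ-≡ a _ _ (begin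
    sumℕ (λ i → ∣ others i ∣) + a           ≡⟨ ∑-distrib-+ (λ i → ∣ others i ∣) (λ i → ∣ B i ∣) ⟨
    sumℕ (λ i → ∣ others i ∣ + ∣ B i ∣)     ≡⟨ ∑-const m ∣others∣ ⟩
    m * a                                   ≡⟨ m*a≡ m ⟩
    a * (m ∸ 1) + a                         ∎)
    where
    open ≡-Reasoning
    a = sumℕ λ i → ∣ B i ∣

    m*a≡ : ∀ m .{{_ : NonZero m}} → m * a ≡ a * (m ∸ 1) + a
    m*a≡ (suc m) = trans (ℕ.+-comm a (m * a)) (cong (ℕ._+ a) (ℕ.*-comm m a))

-- Counting pairs with a given difference

module _ {c ℓ} (G : AbelianGroup c ℓ) {n : ℕ}
         (order : Inverse (AbelianGroup.setoid G) (setoid (Fin n))) where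

  open AbelianGroup G
    using (Carrier; _≈_; _-_; group; identityʳ; comm; ∙-congˡ; ∙-congʳ)
    renaming (_∙_ to _+ᴳ_; ε to 0ᴳ; sym to ≈-sym; trans to ≈-trans)
  open GroupProperties group using (//-rightDividesˡ; //-rightDividesʳ)
  open Inverse order using (to-cong; from-cong; strictlyInverseˡ; strictlyInverseʳ)
    renaming (to to index; from to element)

  origin : Fin n
  origin = index 0ᴳ

  ≢origin⇒≉0 : ∀ {x} → x ≢ origin → ¬ element x ≈ 0ᴳ
  ≢origin⇒≉0 x≢ x≈0 = x≢ (trans (sym (strictlyInverseˡ _)) (to-cong x≈0))

  ≉0⇒≢origin : ∀ {δ} → ¬ δ ≈ 0ᴳ → index δ ≢ origin
  ≉0⇒≢origin δ≉0 δ≡0 = δ≉0 (≈-trans (≈-sym (strictlyInverseʳ _))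
    (≈-trans (from-cong δ≡0) (strictlyInverseʳ _)))

  shift : Fin n → Carrier → Fin n
  shift b δ = index (element b +ᴳ δ)

  shift-≈ : ∀ b {δ ε} → δ ≈ ε → shift b δ ≡ shift b ε
  shift-≈ b δ≈ε = to-cong (∙-congˡ δ≈ε)

  -- Together with `shift⇒difference` this makes `b′` a function of `b` and `δ`. Commutativity
  -- enters because the difference cancels `element b` on the right, while `shift` adds `δ` on the
  -- right.
  difference⇒shift : ∀ {b b′ δ} → element b′ - element b ≈ δ → b′ ≡ shift b δ
  difference⇒shift {b} {b′} diff = trans (sym (strictlyInverseˡ b′)) (to-cong
    (≈-trans (≈-sym (//-rightDividesˡ (element b) (element b′))) (≈-trans (∙-congʳ diff) (comm _ _))))

  shift⇒difference : ∀ b δ → element (shift b δ) - element b ≈ δ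
  shift⇒difference b δ = ≈-trans (∙-congʳ (≈-trans (strictlyInverseʳ _) (comm _ _)))
    (//-rightDividesʳ (element b) δ)

  -- With `b` fixed and the group element varying, `shift` is a bijection of positions. It reindexes
  -- sums over all differences.
  translation : Fin n → Permutation′ n
  translation b = permutation (λ x → shift b (element x)) (λ y → index (element y - element b))
    (λ y → trans (to-cong (≈-trans (∙-congˡ (strictlyInverseʳ _))
      (≈-trans (comm _ _) (//-rightDividesˡ (element b) (element y))))) (strictlyInverseˡ y))
    (λ x → trans (to-cong (shift⇒difference b (element x))) (strictlyInverseˡ x))

  module _ {m : ℕ} (B : Fin m → Subset n) where

    private
      O : Fin m → Subset n
      O = ⋃-others (↔-id (Fin m)) B

    -- For each `b` only `b′ = shift b δ` has the right difference, so the inner sum over `b′`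
    -- collapses to one term. What remains has the shape of the winning count `wins`.
    N≡∑ : ∀ i δ → N G order B i δ ≡ sumℕ λ b → χ (b ∈? B i) * χ (shift b δ ∈? O i)
    N≡∑ i δ = trans (length-filter-cartesianProduct (λ (b , b′) → pair? b b′) id id)
      (sum-cong-≗ λ b →
      trans (∑-single (λ b′ → χ (pair? b b′)) (shift b δ) λ b′ b′≢ →
               χ-no (pair? b b′) λ (_ , _ , diff) → b′≢ (difference⇒shift diff))
            (trans (χ-cong (mk⇔ (λ (b∈ , b′∈ , _) → b∈ , b′∈)
                                (λ (b∈ , b′∈) → b∈ , b′∈ , shift⇒difference b δ))
                      (pair? b (shift b δ)) ((b ∈? B i) ×-dec (shift b δ ∈? O i)))
                   (χ-× (b ∈? B i) (shift b δ ∈? O i))))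
      where
      pair? : ∀ b b′ → Dec (b ∈ B i × b′ ∈ O i × (element b′ - element b) ≈ δ)
      pair? b b′ = (b ∈? B i) ×-dec (b′ ∈? O i) ×-dec _≈?_ G order (element b′ - element b) δ

    N-cong : ∀ i {δ ε} → δ ≈ ε → N G order B i δ ≡ N G order B i ε
    N-cong i {δ} {ε} δ≈ε = trans (N≡∑ i δ) (trans
      (sum-cong-≗ λ b → cong (λ y → χ (b ∈? B i) * χ (y ∈? O i)) (shift-≈ b δ≈ε))
      (sym (N≡∑ i ε)))

    -- Every pair in `B i` times `O i` has exactly one difference, so summing over all differences
    -- counts each pair once.
    ∑N : ∀ i → sumℕ (λ x → N G order B i (element x)) ≡ ∣ B i ∣ * ∣ O i ∣
    ∑N i = begin
      sumℕ (λ x → N G order B i (element x))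
        ≡⟨ sum-cong-≗ (λ x → N≡∑ i (element x)) ⟩
      sumℕ (λ x → sumℕ λ b → χ (b ∈? B i) * χ (shift b (element x) ∈? O i))
        ≡⟨ ∑-comm (λ x b → χ (b ∈? B i) * χ (shift b (element x) ∈? O i)) ⟩
      sumℕ (λ b → sumℕ λ x → χ (b ∈? B i) * χ (shift b (element x) ∈? O i))
        ≡⟨ sum-cong-≗ (λ b → *-distribˡ-sum (χ (b ∈? B i)) λ x → χ (shift b (element x) ∈? O i)) ⟨
      sumℕ (λ b → χ (b ∈? B i) * sumℕ λ x → χ (shift b (element x) ∈? O i))
        -- For fixed `b` the positions `shift b (element x)` run once through `Fin n`, so the inner
        -- sum is the size of `O i`.
        ≡⟨ sum-cong-≗ (λ b → cong (χ (b ∈? B i) *_)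
             (trans (∣p∣≡∑χ (O i)) (sum-permute (λ y → χ (y ∈? O i)) (translation b)))) ⟨
      sumℕ (λ b → χ (b ∈? B i) * ∣ O i ∣)
        ≡⟨ *-distribʳ-sum ∣ O i ∣ (λ b → χ (b ∈? B i)) ⟨
      sumℕ (λ b → χ (b ∈? B i)) * ∣ O i ∣
        ≡⟨ cong (_* ∣ O i ∣) (∣p∣≡∑χ (B i)) ⟨
      ∣ B i ∣ * ∣ O i ∣ ∎
      where open ≡-Reasoning

    -- A pair with difference zero would be one element lying both in `B i` and in the union of the
    -- other blocks.
    N-origin : (∀ i j → i ≢ j → Empty (B i ∩ B j)) → ∀ i → N G order B i (element origin) ≡ 0
    N-origin B-disjoint i = trans (N≡∑ i _) (∑-zero λ b →
      trans (cong (λ y → χ (b ∈? B i) * χ (y ∈? O i)) (shift-origin b)) (∈-and-∉ b))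
      where
      shift-origin : ∀ b → shift b (element origin) ≡ b
      shift-origin b = trans (to-cong (≈-trans (∙-congˡ (strictlyInverseʳ 0ᴳ)) (identityʳ _)))
        (strictlyInverseˡ b)

      ∈-and-∉ : ∀ b → χ (b ∈? B i) * χ (b ∈? O i) ≡ 0
      ∈-and-∉ b = trans (sym (χ-× (b ∈? B i) (b ∈? O i)))
        (χ-no ((b ∈? B i) ×-dec (b ∈? O i)) λ (b∈B , b∈O) → ∉others B B-disjoint b∈B b∈O)

    module _ .{{_ : NonZero m}} {s} {S : Set s} (sources : Fin m ↔ S) where

      open Inverse sources using () renaming
        ( to to source; from to source⁻¹
        ; strictlyInverseˡ to source∘source⁻¹; strictlyInverseʳ to source⁻¹∘source)

      -- Both counts are the same sum of indicators once `source` carries the other blocks over.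
      -- Taking `B` apart from `A`, related only pointwise, lets the lemma serve both
      -- `A = B ∘ source⁻¹` and `B = A ∘ source`.
      wins≡N : (A : S → Subset n) → (∀ i → A (source i) ≡ B i) →
        ∀ i δ → wins G order sources A (source i) δ ≡ N G order B i δ
      wins≡N A A≡B i δ = trans (length-filter-tabulate win? id) (trans
        (sum-cong-≗ λ b → trans
          (χ-cong (mk⇔ (λ (b∈ , y∈) → subst (b ∈_) (A≡B i) b∈ , O⁺ y∈)
                       (λ (b∈ , y∈) → subst (b ∈_) (sym (A≡B i)) b∈ , O⁻ y∈))
            (win? b)
            ((b ∈? B i) ×-dec (shift b δ ∈? O i)))
          (χ-× (b ∈? B i) (shift b δ ∈? O i)))
        (sym (N≡∑ i δ)))
        where
        win? : ∀ b → Dec (b ∈ A (source i) × shift b δ ∈ ⋃-others sources A (source i))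
        win? b = (b ∈? A (source i)) ×-dec (shift b δ ∈? ⋃-others sources A (source i))

        O⁺ : ∀ {y} → y ∈ ⋃-others sources A (source i) → y ∈ O i
        O⁺ {y} y∈ = let t , t≢ , y∈t = ∈⋃-others⁻ sources A y∈ in
          ∈⋃-others⁺ (↔-id _) B
            (λ t⁻¹≡i → t≢ (trans (sym (source∘source⁻¹ t)) (cong source t⁻¹≡i)))
            (subst (y ∈_) (trans (cong A (sym (source∘source⁻¹ t))) (A≡B (source⁻¹ t))) y∈t)
        O⁻ : ∀ {y} → y ∈ O i → y ∈ ⋃-others sources A (source i)
        O⁻ {y} y∈ = let t , t≢ , y∈t = ∈⋃-others⁻ (↔-id _) B y∈ in
          ∈⋃-others⁺ sources A
            (λ eq → t≢ (trans (sym (source⁻¹∘source t)) (trans (cong source⁻¹ eq) (source⁻¹∘source i))))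
            (subst (y ∈_) (sym (A≡B t)) y∈t)

-- Weights with cleared denominators

module _ {c ℓ} (G : AbelianGroup c ℓ) {n : ℕ}
         (order : Inverse (AbelianGroup.setoid G) (setoid (Fin n)))
         {m : ℕ} .{{_ : NonZero m}} (K : Vector ℕ m) .{{k̃≢0 : NonZero (lcm K)}} where

  open AbelianGroup G using (Carrier; _≈_) renaming (ε to 0ᴳ; sym to ≈-sym)
  open Inverse order using (strictlyInverseʳ) renaming (to to index; from to element)

  private
    k̃ = lcm K
    a = sumℕ K
    instance
      m*k̃≢0 : NonZero (m * k̃)
      m*k̃≢0 = ℕ.m*n≢0 m k̃

  -- The integer `k̃ / K i`, read off the divisibility proof so that no division is performed.
  cofactor : Fin m → ℕ
  cofactor i = quotient (∣lcm K i)

  module _ (B : Fin m → Subset n) (sizes : ∀ i → ∣ B i ∣ ≡ K i) where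

    -- The function `W`. Clearing denominators by the lcm, not by the product of the sizes, is what
    -- puts `k̃` into the divisibility condition.
    weight : Carrier → ℕ
    weight δ = sumℕ λ i → cofactor i * N G order B i δ

    weight-cong : ∀ {δ ε} → δ ≈ ε → weight δ ≡ weight ε
    weight-cong δ≈ε = sum-cong-≗ λ i → cong (cofactor i *_) (N-cong G order B i δ≈ε)

    cofactor*size : ∀ i → cofactor i * ∣ B i ∣ ≡ k̃
    cofactor*size i = trans (cong (cofactor i *_) (sizes i)) (sym (_∣_.equality (∣lcm K i)))

    ∑N/size : (B-nonempty : ∀ i → Nonempty (B i)) → ∀ δ →
      sumℚ (λ i → (+ N G order B i δ / ∣ B i ∣) {{size≢0 (B-nonempty i)}}) ≡ + weight δ / k̃
    ∑N/size B-nonempty δ = trans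
      (sumℚ-cong-≗ λ i → /-≡⁺ (N G order B i δ) (cofactor i * N G order B i δ) ∣ B i ∣ k̃
        {{size≢0 (B-nonempty i)}} (cross i))
      (∑-/ k̃ λ i → cofactor i * N G order B i δ)
      where
      cross : ∀ i → N G order B i δ * k̃ ≡ cofactor i * N G order B i δ * ∣ B i ∣
      cross i = trans (cong (N G order B i δ *_) (sym (cofactor*size i)))
        (solve 3 (λ x c b → x :* (c :* b) := c :* x :* b) refl (N G order B i δ) (cofactor i) ∣ B i ∣)
        where open +-*-Solver

    -- As in `∑N/size`, each `1 / k_i` becomes `cofactor i / k̃`, after `wins≡N` has replaced the
    -- winning counts. The uniform choice of the source contributes the factor `m`.
    winProbability≡ : ∀ {s} {S : Set s} (sources : Fin m ↔ S) (A : S → Subset n)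
      (A-nonempty : ∀ s → Nonempty (A s)) → (∀ i → A (Inverse.to sources i) ≡ B i) →
      ∀ Δ → winProbability G order sources A A-nonempty Δ ≡ + weight Δ / (m * k̃)
    winProbability≡ sources A A-nonempty A≡B Δ = begin
      (+ 1 / m) ℚ.* sumℚ (λ i → (+ 1 / size i) {{size≢0ᵢ i}} ℚ.* (+ w i / 1))
        ≡⟨ cong ((+ 1 / m) ℚ.*_) (sumℚ-cong-≗ λ i → trans
             (*-/ 1 (w i) (size i) 1 {{size≢0ᵢ i}})
             (/-≡⁺ (1 * w i) (cofactor i * N G order B i Δ) (size i * 1) k̃
               {{ℕ.m*n≢0 (size i) 1 {{size≢0ᵢ i}}}} (cross i))) ⟩
      (+ 1 / m) ℚ.* sumℚ (λ i → + (cofactor i * N G order B i Δ) / k̃)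
        ≡⟨ cong ((+ 1 / m) ℚ.*_) (∑-/ k̃ λ i → cofactor i * N G order B i Δ) ⟩
      (+ 1 / m) ℚ.* (+ weight Δ / k̃)
        ≡⟨ *-/ 1 (weight Δ) m k̃ ⟩
      + (1 * weight Δ) / (m * k̃)
        ≡⟨ ℚ./-cong (cong +_ (ℕ.*-identityˡ (weight Δ))) refl ⟩
      + weight Δ / (m * k̃) ∎
      where
      open ≡-Reasoning
      open Inverse sources using () renaming (to to source)
      size : Fin m → ℕ
      size i = ∣ A (source i) ∣
      w : Fin m → ℕ
      w i = wins G order sources A (source i) Δ
      size≢0ᵢ : ∀ i → NonZero (size i)
      size≢0ᵢ i = size≢0 (A-nonempty (source i))

      cross : ∀ i → 1 * w i * k̃ ≡ cofactor i * N G order B i Δ * (size i * 1)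
      cross i = begin
        1 * w i * k̃
          ≡⟨ cong₂ (λ x y → 1 * x * y) (wins≡N G order B sources A A≡B i Δ) (sym (cofactor*size i)) ⟩
        1 * N G order B i Δ * (cofactor i * ∣ B i ∣)
          ≡⟨ solve 3 (λ x c b → con 1 :* x :* (c :* b) := c :* x :* (b :* con 1)) refl
               (N G order B i Δ) (cofactor i) ∣ B i ∣ ⟩
        cofactor i * N G order B i Δ * (∣ B i ∣ * 1)
          ≡⟨ cong (λ p → cofactor i * N G order B i Δ * (∣ p ∣ * 1)) (A≡B i) ⟨
        cofactor i * N G order B i Δ * (size i * 1) ∎
        where open +-*-Solver

    module _ (B-disjoint : ∀ i j → i ≢ j → Empty (B i ∩ B j)) where

      weight-origin : weight (element (origin G order)) ≡ 0
      weight-origin = ∑-zero λ i → trans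
        (cong (cofactor i *_) (N-origin G order B B-disjoint i)) (ℕ.*-zeroʳ (cofactor i))

      -- The reciprocal weighting cancels the block size: block `i` contributes `cofactor i` times
      -- its size times the size of `O i`, which is `k̃` times the size of `O i`. The sizes of the
      -- `O i` add up to `a * (m ∸ 1)`.
      ∑weight : sumℕ (λ x → weight (element x)) ≡ k̃ * (a * (m ∸ 1))
      ∑weight = begin
        sumℕ (λ x → sumℕ λ i → cofactor i * N G order B i (element x))
          ≡⟨ ∑-comm (λ x i → cofactor i * N G order B i (element x)) ⟩
        sumℕ (λ i → sumℕ λ x → cofactor i * N G order B i (element x))
          ≡⟨ sum-cong-≗ (λ i → *-distribˡ-sum (cofactor i) λ x → N G order B i (element x)) ⟨
        sumℕ (λ i → cofactor i * sumℕ λ x → N G order B i (element x))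
          ≡⟨ sum-cong-≗ (λ i → trans (cong (cofactor i *_) (∑N G order B i))
               (trans (sym (ℕ.*-assoc (cofactor i) ∣ B i ∣ _)) (cong (_* ∣ O i ∣) (cofactor*size i)))) ⟩
        sumℕ (λ i → k̃ * ∣ O i ∣)
          ≡⟨ *-distribˡ-sum k̃ (λ i → ∣ O i ∣) ⟨
        k̃ * sumℕ (λ i → ∣ O i ∣)
          ≡⟨ cong (k̃ *_) (∑∣others∣ B B-disjoint) ⟩
        k̃ * (sumℕ (λ i → ∣ B i ∣) * (m ∸ 1))
          ≡⟨ cong (λ a → k̃ * (a * (m ∸ 1))) (sum-cong-≗ sizes) ⟩
        k̃ * (a * (m ∸ 1)) ∎
        where
        open ≡-Reasoning
        O : Fin m → Subset n
        O = others B B-disjoint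

      -- The whole sum comes from `n ∸ 1` equal values, since the weight vanishes at zero.
      constant⇒weight≡mean : (∀ δ ε → ¬ δ ≈ 0ᴳ → ¬ ε ≈ 0ᴳ → weight δ ≡ weight ε) →
        ∀ δ → ¬ δ ≈ 0ᴳ → (n ∸ 1) * weight δ ≡ k̃ * (a * (m ∸ 1))
      constant⇒weight≡mean constant δ δ≉0 = trans
        (sym (∑-punctured-const (weight ∘ element) (origin G order) weight-origin
          λ x x≢0 → constant (element x) δ (≢origin⇒≉0 G order x≢0) δ≉0))
        ∑weight

      -- An average of values that never exceed it is attained by each of them. Everything is
      -- multiplied by `n ∸ 1` because the mean is not yet known to be an integer.
      bounded⇒weight≡mean : (∀ δ → ¬ δ ≈ 0ᴳ → (n ∸ 1) * weight δ ≤ k̃ * (a * (m ∸ 1))) →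
        ∀ δ → ¬ δ ≈ 0ᴳ → (n ∸ 1) * weight δ ≡ k̃ * (a * (m ∸ 1))
      bounded⇒weight≡mean bounded δ δ≉0 = trans
        -- The sum runs over positions, so `δ` is first replaced by `element (index δ)`.
        (cong ((n ∸ 1) *_) (weight-cong (≈-sym (strictlyInverseʳ δ))))
        (∑-punctured-≤-tight (λ x → (n ∸ 1) * weight (element x)) (origin G order)
          (trans (cong ((n ∸ 1) *_) weight-origin) (ℕ.*-zeroʳ (n ∸ 1)))
          (λ x x≢0 → bounded (element x) (≢origin⇒≉0 G order x≢0))
          (trans (sym (*-distribˡ-sum (n ∸ 1) (weight ∘ element))) (cong ((n ∸ 1) *_) ∑weight))
          (index δ) (≉0⇒≢origin G order δ≉0))

  -- The two constructions and the divisibility condition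

  module _ .{{_ : NonTrivial n}} where

    private instance
      n-1≢0 : NonZero (n ∸ 1)
      n-1≢0 = n∸1≢0 n
      m*n-1≢0 : NonZero (m * (n ∸ 1))
      m*n-1≢0 = ℕ.m*n≢0 m (n ∸ 1)

    -- Serves as the point where the quotient is read off and as a shift attaining the maximum.
    nonzero : ∃[ δ ] ¬ δ ≈ 0ᴳ
    nonzero = let x , x≢0 = ∃≢ (origin G order) in element x , ≢origin⇒≉0 G order x≢0

    module _ {B : Fin m → Subset n} {d : ℚ} (R : IsRWEDF G order K a d B) where
      open IsRWEDF R

      -- The sums at any two nonzero elements both equal `d`. Over the common denominator `k̃` their
      -- numerators agree, so the weight is constant off zero.
      rwedf-weight≡mean : ∀ δ → ¬ δ ≈ 0ᴳ → (n ∸ 1) * weight B sizes δ ≡ k̃ * (a * (m ∸ 1))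
      rwedf-weight≡mean = constant⇒weight≡mean B sizes disjoint λ δ ε δ≉0 ε≉0 →
        /-≡⁻ (weight B sizes δ) (weight B sizes ε) k̃
          (trans (sym (∑N/size B sizes nonempty δ)) (trans (reciprocal δ δ≉0)
            (trans (sym (reciprocal ε ε≉0)) (∑N/size B sizes nonempty ε))))

      rwedf⇒∣ : (n ∸ 1) ∣ (k̃ * a * (m ∸ 1))
      rwedf⇒∣ = let δ , δ≉0 = nonzero in divides (weight B sizes δ) (begin
        k̃ * a * (m ∸ 1)            ≡⟨ ℕ.*-assoc k̃ a (m ∸ 1) ⟩
        k̃ * (a * (m ∸ 1))          ≡⟨ rwedf-weight≡mean δ δ≉0 ⟨
        (n ∸ 1) * weight B sizes δ ≡⟨ ℕ.*-comm (n ∸ 1) _ ⟩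
        weight B sizes δ * (n ∸ 1) ∎)
        where open ≡-Reasoning

      -- The blocks are relabelled by sources. Every nonzero shift then wins with probability
      -- exactly `R-bound n m a`, which gives both the upper bound and its attainment.
      rwedf⇒amd : ∀ {s} {S : Set s} (sources : Fin m ↔ S) →
        ∃[ ρ ] ∃[ A ] (IsWeakAMDCode G order sources a ρ A
          × (∀ i → ∣ A (Inverse.to sources i) ∣ ≡ K i) × ρ ≡ R-bound n m a)
      rwedf⇒amd sources = R-bound n m a , A , record
        { isDisjointFamily = record
          { nonempty = λ s → nonempty (source⁻¹ s)
          ; disjoint = λ s t s≢t → disjoint (source⁻¹ s) (source⁻¹ t) λ eq → s≢t
              (trans (sym (source∘source⁻¹ s)) (trans (cong source eq) (source∘source⁻¹ t)))
          }
        ; total      = sum-cong-≗ ∣A∣≡K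
        ; ρ-bounds   = λ Δ Δ≉0 → ℚ.≤-reflexive (probability Δ Δ≉0)
        ; ρ-attained = let Δ , Δ≉0 = nonzero in Δ , Δ≉0 , probability Δ Δ≉0
        } , ∣A∣≡K , refl
        where
        open Inverse sources using () renaming
          ( to to source; from to source⁻¹
          ; strictlyInverseˡ to source∘source⁻¹; strictlyInverseʳ to source⁻¹∘source)
        A = B ∘ source⁻¹

        A≡B : ∀ i → A (source i) ≡ B i
        A≡B i = cong B (source⁻¹∘source i)

        ∣A∣≡K : ∀ i → ∣ A (source i) ∣ ≡ K i
        ∣A∣≡K i = trans (cong ∣_∣ (A≡B i)) (sizes i)

        probability : ∀ Δ → ¬ Δ ≈ 0ᴳ →
          winProbability G order sources A (nonempty ∘ source⁻¹) Δ ≡ R-bound n m a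
        probability Δ Δ≉0 = trans
          (winProbability≡ B sizes sources A (nonempty ∘ source⁻¹) A≡B Δ)
          (/-≡⁺ W (a * (m ∸ 1)) (m * k̃) (m * (n ∸ 1)) (begin
            W * (m * (n ∸ 1))
              ≡⟨ solve 3 (λ w m n → w :* (m :* n) := m :* (n :* w)) refl W m (n ∸ 1) ⟩
            m * ((n ∸ 1) * W)
              ≡⟨ cong (m *_) (rwedf-weight≡mean Δ Δ≉0) ⟩
            m * (k̃ * (a * (m ∸ 1)))
              ≡⟨ solve 3 (λ m k x → m :* (k :* x) := x :* (m :* k)) refl m k̃ (a * (m ∸ 1)) ⟩
            a * (m ∸ 1) * (m * k̃) ∎))
          where
          open ≡-Reasoning
          open +-*-Solver
          W = weight B sizes Δ

    amd⇒rwedf : ∀ {s} {S : Set s} (sources : Fin m ↔ S) {A : S → Subset n} →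
      IsWeakAMDCode G order sources a (R-bound n m a) A →
      (∀ i → ∣ A (Inverse.to sources i) ∣ ≡ K i) →
      ∃[ d ] ∃[ B ] IsRWEDF G order K a d B
    -- The value of `d` is the mean weight divided by `k̃`.
    amd⇒rwedf sources {A} code sizes = + (a * (m ∸ 1)) / (n ∸ 1) , B , record
      { isDisjointFamily = record { nonempty = nonempty ∘ source ; disjoint = B-disjoint }
      ; sizes      = sizes
      ; total      = refl
      ; reciprocal = λ δ δ≉0 → trans (∑N/size B sizes (nonempty ∘ source) δ)
          (/-≡⁺ (W δ) (a * (m ∸ 1)) k̃ (n ∸ 1) (trans (ℕ.*-comm (W δ) (n ∸ 1))
            (trans (bounded⇒weight≡mean B sizes B-disjoint bounded δ δ≉0)
              (ℕ.*-comm k̃ (a * (m ∸ 1))))))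
      }
      where
      open IsWeakAMDCode code using (nonempty; disjoint; ρ-bounds)
      open Inverse sources using () renaming
        (to to source; from to source⁻¹; strictlyInverseʳ to source⁻¹∘source)
      B = A ∘ source
      W = weight B sizes

      B-disjoint : ∀ i j → i ≢ j → Empty (B i ∩ B j)
      B-disjoint i j i≢j = disjoint (source i) (source j) λ eq → i≢j
        (trans (sym (source⁻¹∘source i)) (trans (cong source⁻¹ eq) (source⁻¹∘source j)))

      -- Cross-multiplied, the inequality between the winning probability and `R-bound n m a` says
      -- that the weight is at most its mean, up to a factor `m` that cancels.
      bounded : ∀ δ → ¬ δ ≈ 0ᴳ → (n ∸ 1) * W δ ≤ k̃ * (a * (m ∸ 1))
      bounded δ δ≉0 = ℕ.*-cancelˡ-≤ m (begin
        m * ((n ∸ 1) * W δ)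
          ≡⟨ solve 3 (λ w m n → m :* (n :* w) := w :* (m :* n)) refl (W δ) m (n ∸ 1) ⟩
        W δ * (m * (n ∸ 1))
          ≤⟨ /-≤⁻ (W δ) (a * (m ∸ 1)) (m * k̃) (m * (n ∸ 1))
               (subst (ℚ._≤ R-bound n m a)
                 (winProbability≡ B sizes sources A nonempty (λ _ → refl) δ) (ρ-bounds δ δ≉0)) ⟩
        a * (m ∸ 1) * (m * k̃)
          ≡⟨ solve 3 (λ m k x → x :* (m :* k) := m :* (k :* x)) refl m k̃ (a * (m ∸ 1)) ⟩
        m * (k̃ * (a * (m ∸ 1))) ∎)
        where
        open ℕ.≤-Reasoning
        open +-*-Solver

corollary4 :
    ∀ {c ℓ s} {n m : ℕ} .{{_ : NonTrivial n}} .{{_ : NonZero m}}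
    (G : AbelianGroup c ℓ)
    (order : Inverse (AbelianGroup.setoid G) (setoid (Fin n)))
    (S : Set s) (sources : Fin m ↔ S)
    (K : Vector ℕ m) → (∀ i → NonZero (K i)) →
    let a  = sumℕ K
        k̃  = lcm K
        RWEDF-exists = ∃[ d ] ∃[ B ] IsRWEDF G order K a d B
        AMD-exists   = ∃[ ρ ] ∃[ A ] (IsWeakAMDCode G order sources a ρ A
                         × (∀ i → ∣ A (Inverse.to sources i) ∣ ≡ K i)
                         × ρ ≡ R-bound n m a)
    in (RWEDF-exists ⇔ AMD-exists)
       × (RWEDF-exists → (n ∸ 1) ∣ (k̃ * a * (m ∸ 1)))
       × (AMD-exists → (n ∸ 1) ∣ (k̃ * a * (m ∸ 1)))
corollary4 {n = n} {m} G order S sources K K≢0 =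
  mk⇔ toAMD toRWEDF , necessary , necessary ∘ toRWEDF
  where
  instance
    k̃≢0 : NonZero (lcm K)
    k̃≢0 = lcm≢0 K K≢0

  RWEDF-exists = ∃[ d ] ∃[ B ] IsRWEDF G order K (sumℕ K) d B
  AMD-exists   = ∃[ ρ ] ∃[ A ] (IsWeakAMDCode G order sources (sumℕ K) ρ A
    × (∀ i → ∣ A (Inverse.to sources i) ∣ ≡ K i) × ρ ≡ R-bound n m (sumℕ K))

  toAMD : RWEDF-exists → AMD-exists
  toAMD (_ , _ , R) = rwedf⇒amd G order K R sources

  toRWEDF : AMD-exists → RWEDF-exists
  -- Matching on `refl` replaces the maximal winning probability by `R-bound n m (sumℕ K)`.
  toRWEDF (_ , _ , code , sizes , refl) = amd⇒rwedf G order K sources code sizes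

  necessary : RWEDF-exists → (n ∸ 1) ∣ (lcm K * sumℕ K * (m ∸ 1))
  necessary (_ , _ , R) = rwedf⇒∣ G order K R
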